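{- Let $f:\mathbb{Z}^{+}\to\mathbb{C}$ be any function and let $g_f(m)=\sum_{d\mid m} f(d)$ for $m\ge1$. Then for all $n\ge 1$, $$g_f(n+1)=\sum_{b=\pm1}\ \sum_{k=1}^{\left\lfloor\frac{\sqrt{24n+1}-b}{6}\right\rfloor}(-1)^{k+1}\,g_f\!\left(n+1-\frac{k(3k+b)}{2}\right)+a_f(n+1),$$ where the sequence $a_f$ is defined in the context.
   Context: The pair $(f,g_f)$ is related by the Lambert series $\sum_{n\ge1} \frac{f(n)q^n}{1-q^n}=\sum_{m\ge1} g_f(m)q^m$ (equivalently $g_f(m)=\sum_{d\mid m}f(d)$). Iverson bracket: $[P]_\delta=1$ if the condition $P$ is true and $0$ otherwise. For integers $n,i\ge 1$ define $$a_{n,i} = \sum_{b=\pm1}\ \sum_{s=0}^{\lfloor n/i\rfloor-1} (-1)^{\left\lfloor \frac{\sqrt{24(n-(s+1)i)+1}-b}{6}\right\rfloor}\left[\frac{\sqrt{24(n-(s+1)i)+1}-b}{6}\in\mathbb{Z}\right]_\delta ,$$ i.e. $a_{n,i}$ is the sum of $(-1)^k$ over all ways of writing $n=(s+1)i+\frac{k(3k\pm1)}{2}$ with integers $k,s\ge0$ (for each $s$, the value $k=0$ is counted only once, not once for each sign). For integers $n\ge0$ define $$a_f(n)=\sum_{i=1}^{n} f(i)\,a_{n,i}+[n=0]_\delta .$$ -}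

module Defs where

open import Algebra.Bundles using (CommutativeRing)
open import Data.Bool.Base using (if_then_else_)
open import Data.Fin.Base using (toℕ)
open import Data.Integer.Base as ℤ using (ℤ; +_; ∣_∣; 0ℤ; 1ℤ; -1ℤ)
open import Data.Integer.DivMod using (_/ℕ_; [n/ℕd]*d≤n; n<s[n/ℕd]*d)
open import Data.Integer.Divisibility.Signed using (_∣_; divides; _∣?_)
import Data.Integer.Properties as ℤ
open import Data.Integer.Tactic.RingSolver using (solve-∀)
open import Data.Nat.Base using (ℕ; zero; suc; _+_; _*_; _∸_; _≤_; _<_; _/_; z≤n; s≤s; NonZero)
open import Data.Nat.Divisibility using () renaming (_∣?_ to _∣ℕ?_)
import Data.Nat.Properties as ℕ
open import Data.Product.Base using (_×_; _,_; ∃; proj₁; proj₂)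
open import Data.Sum.Base using (_⊎_; inj₁; inj₂)
open import Function.Bundles using (_⇔_; mk⇔; module Equivalence)
open import Relation.Binary.PropositionalEquality using (_≡_; refl; sym; trans; cong; subst)
open import Relation.Nullary using (Dec; yes; no; does)
open import Relation.Nullary.Decidable using (_×-dec_; map′)

-- Square roots.  There are no real numbers here, so comparisons of an
-- integer with the real number √N are expressed by squaring: z ≡√ N
-- stands for z = √N, and z ≤√ N for z ≤ √N.

infix 4 _≡√_ _≤√_

_≡√_ : ℤ → ℕ → Set
z ≡√ N = 0ℤ ℤ.≤ z × z ℤ.* z ≡ + N

_≤√_ : ℤ → ℕ → Set
z ≤√ N = z ℤ.≤ 0ℤ ⊎ z ℤ.* z ℤ.≤ + N

⌊√_⌋ : ℕ → ℕ
⌊√ zero ⌋  = zero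
⌊√ suc N ⌋ with ⌊√ N ⌋
... | r with suc r * suc r ℕ.≤? suc N
...   | yes _ = suc r
...   | no  _ = r

-- The floor of (√N − b)/6.  Since b is an integer, √N may first be
-- replaced by its own floor; ⌊√−/6⌋-spec below confirms that this is the
-- floor of the real number.
⌊[√_−_]/6⌋ : ℕ → ℤ → ℤ
⌊[√ N − b ]/6⌋ = (+ ⌊√ N ⌋ ℤ.- b) /ℕ 6

[√_−_]/6∈ℤ : ℕ → ℤ → Set
[√ N − b ]/6∈ℤ = ∃ λ k → (+ 6 ℤ.* k ℤ.+ b) ≡√ N

⌊√⌋-spec : ∀ N → ⌊√ N ⌋ * ⌊√ N ⌋ ≤ N × N < suc ⌊√ N ⌋ * suc ⌊√ N ⌋
⌊√⌋-spec zero = z≤n , s≤s z≤n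
⌊√⌋-spec (suc N) with ⌊√ N ⌋ | ⌊√⌋-spec N
... | r | lo , hi with suc r * suc r ℕ.≤? suc N
...   | no  r²≰N = ℕ.m≤n⇒m≤1+n lo , ℕ.≰⇒> r²≰N
...   | yes r²≤N = r²≤N ,
  ℕ.≤-<-trans hi (ℕ.*-mono-< (ℕ.n<1+n (suc r)) (ℕ.n<1+n (suc r)))

m²<n²⇒m<n : ∀ {m n} → m * m < n * n → m < n
m²<n²⇒m<n m²<n² = ℕ.≰⇒> λ n≤m → ℕ.<⇒≱ m²<n² (ℕ.*-mono-≤ n≤m n≤m)

⌊√⌋-unique : ∀ r N → r * r ≡ N → r ≡ ⌊√ N ⌋
⌊√⌋-unique r N refl with ⌊√⌋-spec (r * r)
... | lo , hi = ℕ.≤-antisym (ℕ.≤-pred (m²<n²⇒m<n hi))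
                  (ℕ.≤-pred (m²<n²⇒m<n (ℕ.≤-<-trans lo (ℕ.*-mono-< (ℕ.n<1+n r) (ℕ.n<1+n r)))))

≤√⇔≤⌊√⌋ : ∀ z N → (z ≤√ N) ⇔ (z ℤ.≤ + ⌊√ N ⌋)
≤√⇔≤⌊√⌋ z N = mk⇔ (to z) (from z)
  where
  to : ∀ z → z ≤√ N → z ℤ.≤ + ⌊√ N ⌋
  to z (inj₁ z≤0) = ℤ.≤-trans z≤0 (ℤ.+≤+ z≤n)
  to (+ m) (inj₂ m²≤N) = ℤ.+≤+ (ℕ.≤-pred (m²<n²⇒m<n
    (ℕ.≤-<-trans (ℤ.drop‿+≤+ (subst (ℤ._≤ + N) (sym (ℤ.pos-* m m)) m²≤N))
                 (proj₂ (⌊√⌋-spec N)))))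
  to ℤ.-[1+ m ] (inj₂ _) = ℤ.-≤+
  from : ∀ z → z ℤ.≤ + ⌊√ N ⌋ → z ≤√ N
  from (+ m) (ℤ.+≤+ m≤r) = inj₂ (subst (ℤ._≤ + N) (ℤ.pos-* m m)
    (ℤ.+≤+ (ℕ.≤-trans (ℕ.*-mono-≤ m≤r m≤r) (proj₁ (⌊√⌋-spec N)))))
  from ℤ.-[1+ m ] _ = inj₁ ℤ.-≤+

⌊√−/6⌋-spec : ∀ N b k → (k ℤ.≤ ⌊[√ N − b ]/6⌋) ⇔ ((+ 6 ℤ.* k ℤ.+ b) ≤√ N)
⌊√−/6⌋-spec N b k = mk⇔ to from
  where
  open ℤ.≤-Reasoning
  r = + ⌊√ N ⌋
  q = ⌊[√ N − b ]/6⌋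
  to : k ℤ.≤ q → (+ 6 ℤ.* k ℤ.+ b) ≤√ N
  to k≤q = Equivalence.from (≤√⇔≤⌊√⌋ _ N) (begin
    + 6 ℤ.* k ℤ.+ b   ≡⟨ cong (ℤ._+ b) (ℤ.*-comm (+ 6) k) ⟩
    k ℤ.* + 6 ℤ.+ b   ≤⟨ ℤ.+-monoˡ-≤ b (ℤ.*-monoʳ-≤-nonNeg (+ 6) k≤q) ⟩
    q ℤ.* + 6 ℤ.+ b   ≤⟨ ℤ.+-monoˡ-≤ b ([n/ℕd]*d≤n (r ℤ.- b) 6) ⟩
    r ℤ.- b ℤ.+ b     ≡⟨ lem r b ⟩
    r                 ∎)
    where
    lem : ∀ r b → r ℤ.- b ℤ.+ b ≡ r
    lem = solve-∀
  from : (+ 6 ℤ.* k ℤ.+ b) ≤√ N → k ℤ.≤ q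
  from h = ℤ.≮⇒≥ λ q<k → ℤ.<-irrefl refl (begin-strict
    r ℤ.- b                     <⟨ n<s[n/ℕd]*d (r ℤ.- b) 6 ⟩
    ℤ.suc q ℤ.* + 6             ≤⟨ ℤ.*-monoʳ-≤-nonNeg (+ 6) (ℤ.i<j⇒suc[i]≤j q<k) ⟩
    k ℤ.* + 6                   ≡⟨ lem k b ⟩
    + 6 ℤ.* k ℤ.+ b ℤ.- b       ≤⟨ ℤ.+-monoˡ-≤ (ℤ.- b) (Equivalence.to (≤√⇔≤⌊√⌋ _ N) h) ⟩
    r ℤ.- b                     ∎)
    where
    lem : ∀ k b → k ℤ.* + 6 ≡ + 6 ℤ.* k ℤ.+ b ℤ.- b
    lem = solve-∀

[√_−_]/6∈ℤ? : ∀ N b → Dec [√ N − b ]/6∈ℤ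
[√ N − b ]/6∈ℤ? =
  map′ to from (⌊√ N ⌋ * ⌊√ N ⌋ ℕ.≟ N ×-dec + 6 ∣? (+ ⌊√ N ⌋ ℤ.- b))
  where
  lem₁ : ∀ k b → + 6 ℤ.* k ℤ.+ b ≡ k ℤ.* + 6 ℤ.- ℤ.- b
  lem₁ = solve-∀
  lem₂ : ∀ r b → r ℤ.- b ℤ.- ℤ.- b ≡ r
  lem₂ = solve-∀
  lem₃ : ∀ k b → + 6 ℤ.* k ℤ.+ b ℤ.- b ≡ k ℤ.* + 6
  lem₃ = solve-∀
  Square∧6∣ : Set
  Square∧6∣ = ⌊√ N ⌋ * ⌊√ N ⌋ ≡ N × + 6 ∣ (+ ⌊√ N ⌋ ℤ.- b)
  to : Square∧6∣ → [√ N − b ]/6∈ℤ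
  to (r²≡N , divides k r-b≡6k) = k ,
    subst (_≡√ N) (sym eq) (ℤ.+≤+ z≤n , trans (sym (ℤ.pos-* ⌊√ N ⌋ ⌊√ N ⌋)) (cong +_ r²≡N))
    where
    eq : + 6 ℤ.* k ℤ.+ b ≡ + ⌊√ N ⌋
    eq = trans (lem₁ k b) (trans (cong (ℤ._- ℤ.- b) (sym r-b≡6k)) (lem₂ (+ ⌊√ N ⌋) b))
  from : [√ N − b ]/6∈ℤ → Square∧6∣
  from (k , 0≤z , z²≡N) with + 6 ℤ.* k ℤ.+ b in eq
  ... | + m = subst (λ r → r * r ≡ N) m≡r m²≡N ,
              subst (λ r → + 6 ∣ (+ r ℤ.- b)) m≡r
                (divides k (trans (cong (ℤ._- b) (sym eq)) (lem₃ k b)))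
    where
    m²≡N : m * m ≡ N
    m²≡N = ℤ.+-injective (trans (ℤ.pos-* m m) z²≡N)
    m≡r : m ≡ ⌊√ N ⌋
    m≡r = ⌊√⌋-unique m N m²≡N

-- k(3k + b)/2 for b = ±1.  The product k(3k + b) is then an even
-- non-negative integer, so neither /ℕ nor ∣_∣ loses anything.
pentagonal : ℤ → ℕ → ℕ
pentagonal b k = ∣ (+ k ℤ.* (+ 3 ℤ.* + k ℤ.+ b)) /ℕ 2 ∣

-- The number ⌊(√(24n+1) − b)/6⌋.  For b = ±1 it is non-negative (as
-- √(24n+1) ≥ 1), so passing to ℕ by ∣_∣ does not change it.
index : ℤ → ℕ → ℕ
index b n = ∣ ⌊[√ 24 * n + 1 − b ]/6⌋ ∣

module Sequences {c ℓ} (R : CommutativeRing c ℓ) where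

  open CommutativeRing R using (Carrier; 0#; 1#; -_; semiring)
    renaming (_+_ to _⊕_; _*_ to _⊗_)
  open import Algebra.Properties.Semiring.Sum semiring using (sum-syntax) public
  open import Algebra.Properties.Semiring.Exp semiring using (_^_) public

  -- Functions from the positive integers to R.
  ArithmeticFunction : Set c
  ArithmeticFunction = (n : ℕ) → .{{NonZero n}} → Carrier

  -- The Iverson bracket.
  [_]δ : ∀ {p} {P : Set p} → Dec P → Carrier
  [ P? ]δ = if does P? then 1# else 0#

  -- The sum over k from 1 to n inclusive.
  ∑₁ : (n : ℕ) → ((k : ℕ) → .{{NonZero k}} → Carrier) → Carrier
  ∑₁ n F = ∑[ j < n ] F (suc (toℕ j))

  ∑± : (ℤ → Carrier) → Carrier
  ∑± F = F 1ℤ ⊕ F -1ℤ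

  -- g f m is the sum of f d over the divisors d of m, for m ≥ 1.
  -- At m = 0 it is an empty sum.  For 1 ≤ k ≤ index b n one has
  -- pentagonal b k ≤ n, so n + 1 ∸ pentagonal b k is never 0 there.
  g : ArithmeticFunction → ℕ → Carrier
  g f m = ∑₁ m λ d → [ d ∣ℕ? m ]δ ⊗ f d

  -- a n i is an integer, taken here as an element of R.  For s < n / i one
  -- has (s + 1) i ≤ n, so ∸ is a true subtraction.
  a : (n i : ℕ) → .{{NonZero i}} → Carrier
  a n i = ∑± λ b → ∑[ s < n / i ]
    (let m = n ∸ suc (toℕ s) * i in
     ((- 1#) ^ index b m) ⊗ [ [√ 24 * m + 1 − b ]/6∈ℤ? ]δ)

  a[_] : ArithmeticFunction → ℕ → Carrier
  a[ f ] n = (∑₁ n λ i → f i ⊗ a n i) ⊕ [ n ℕ.≟ 0 ]δ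

{-# OPTIONS --safe #-}
module Submission where

-- Write e b m for (-1)^k if m = k(3k + b)/2 for some k, and 0 otherwise, where
-- k = 0 is admitted for b = 1 only.  Then a N i is the sum over b of the
-- numbers e b (N - s i), taken over the multiples s i of i up to N with s ≥ 1.
-- In the sum of f i * a N i over i ≤ N, collecting the terms with the same
-- value m = s i turns the coefficient into the sum of f i over the divisors i
-- of m, so that
--
--     a[ f ] N  =  sum over b of  sum over 1 ≤ m ≤ N of  g f m * e b (N - m)
--
-- for N ≥ 1 (lambert and convolution): this is the coefficient of q^N in the
-- product of the Lambert series of f by the series of coefficients
-- e 1 m + e -1 m.  With m = N - j and N = n + 1, the term j = 0 of the right
-- side is g f (n + 1), and the terms with 1 ≤ j ≤ n vanish unless j is a
-- pentagonal number k(3k + b)/2 with 1 ≤ k ≤ index b n, where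
-- e b j = (-1)^k (pentagonal-sum).  The first sum of the recurrence is the
-- negative of the latter, so the two cancel and g f (n + 1) remains.  Euler's
-- product formula for the pentagonal series is not needed.
--
-- Both reductions of a sum over all m ≤ n to the values of an increasing
-- sequence, the multiples of i and the pentagonal numbers, are instances of
-- one lemma, ∑-image.  It is proved by induction on n from the fact that
-- the counting function of the sequence, n / i and index b n respectively, is
-- adjoint to it (Counts, multiples, pentagonals).

open import Defs
open import Algebra.Bundles using (CommutativeRing)
open import Data.Nat.Base using (ℕ; _∸_; _≤_) renaming (_+_ to _+ℕ_)

open import Data.Fin.Base using (toℕ; opposite)
open import Data.Fin.Permutation using (reverse)
open import Data.Fin.Properties using (opposite-prop; toℕ<n)
open import Data.Integer.Base as ℤ using (ℤ; +_; -[1+_]; 0ℤ; 1ℤ; -1ℤ; ∣_∣)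
open import Data.Integer.DivMod using (_/ℕ_)
import Data.Integer.Properties as ℤ
open import Data.Integer.Tactic.RingSolver using (solve-∀)
open import Data.Nat.Base using (zero; suc; _<_; _/_; z≤n; s≤s; NonZero) renaming (_*_ to _*ℕ_)
open import Data.Nat.Divisibility using (_∣_; divides; ∣⇒≤) renaming (_∣?_ to _∣ℕ?_)
open import Data.Nat.DivMod using (m/n*n≤m; m*n/n≡m; /-monoˡ-≤)
import Data.Nat.Properties as ℕ
open import Data.Product.Base using (∃; _,_; proj₁; proj₂)
open import Data.Sum.Base using (_⊎_; inj₁; inj₂)
open import Function.Base using (_∘_)
open import Function.Bundles using (_⇔_; mk⇔; module Equivalence)
open import Relation.Binary.PropositionalEquality
  using (_≡_; refl; sym; trans; cong; cong₂; subst; subst₂; module ≡-Reasoning)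
open import Relation.Nullary using (Dec; yes; no; ¬_; contradiction)
open import Relation.Nullary.Decidable using (dec-true; dec-false)

open Equivalence using (to; from)

-- Counting functions of increasing sequences

-- p is a strictly increasing sequence and c n is the largest k with p k ≤ n.
-- As p 0 = 0 follows (p-zero), c n is also the number of values of p in the
-- range from 1 to n.
record Counts (c p : ℕ → ℕ) : Set where
  field
    increasing : ∀ k → p k < p (suc k)
    adjoint    : ∀ k n → k ≤ c n ⇔ p k ≤ n

  p≤ : ∀ n → p (c n) ≤ n
  p≤ n = to (adjoint _ n) ℕ.≤-refl

  c∘p : ∀ k → c (p k) ≡ k
  c∘p k = ℕ.≤-antisym
    (ℕ.≮⇒≥ λ k<c → ℕ.<⇒≱ (increasing k) (to (adjoint _ _) k<c))
    (from (adjoint k _) ℕ.≤-refl)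

  p-zero : p 0 ≡ 0
  p-zero = ℕ.n≤0⇒n≡0 (to (adjoint 0 0) z≤n)

  c-zero : c 0 ≡ 0
  c-zero = trans (cong c (sym p-zero)) (c∘p 0)

  -- Between n and n + 1 the function c grows by one if n + 1 is a value of p,
  -- and stays constant if it is not (c-miss).
  c-hit : ∀ {n k} → p k ≡ suc n → c (suc n) ≡ suc (c n)
  c-hit {n} {zero} eq with trans (sym p-zero) eq
  ... | ()
  c-hit {n} {suc k} eq = trans (trans (cong c (sym eq)) (c∘p (suc k))) (cong suc (ℕ.≤-antisym
    (from (adjoint k n) (ℕ.≤-pred (subst (p k <_) eq (increasing k))))
    (ℕ.≮⇒≥ λ k<c → ℕ.<-irrefl refl (subst (_≤ n) eq (to (adjoint _ n) k<c)))))

  c-miss : ∀ {n} → ¬ (∃ λ k → p k ≡ suc n) → c (suc n) ≡ c n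
  c-miss {n} ∄k = ℕ.≤-antisym
    (from (adjoint _ n) (ℕ.≤-pred (ℕ.≤∧≢⇒< (p≤ (suc n)) (λ eq → ∄k (_ , eq)))))
    (from (adjoint _ (suc n)) (ℕ.m≤n⇒m≤1+n (p≤ n)))

multiples : ∀ i .{{_ : NonZero i}} → Counts (_/ i) (_*ℕ i)
multiples i@(suc _) = record
  { increasing = λ k → ℕ.m<n+m (k *ℕ i) (s≤s z≤n)
  ; adjoint    = λ k n → mk⇔
      (λ k≤n/i → ℕ.≤-trans (ℕ.*-monoˡ-≤ i k≤n/i) (m/n*n≤m n i))
      (λ k*i≤n → subst (_≤ n / i) (m*n/n≡m k i) (/-monoˡ-≤ i k*i≤n))
  }

-- Generalised pentagonal numbers

±1-square : ∀ {b} → b ≡ 1ℤ ⊎ b ≡ -1ℤ → b ℤ.* b ≡ 1ℤ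
±1-square (inj₁ refl) = refl
±1-square (inj₂ refl) = refl

half : ∀ {b} → b ≡ 1ℤ ⊎ b ≡ -1ℤ → ∃ λ h → 1ℤ ℤ.+ b ≡ + 2 ℤ.* + h
half (inj₁ refl) = 1 , refl
half (inj₂ refl) = 0 , refl

0<6+b : ∀ {b} → b ≡ 1ℤ ⊎ b ≡ -1ℤ → 0ℤ ℤ.< + 6 ℤ.+ b
0<6+b (inj₁ refl) = ℤ.+<+ (s≤s z≤n)
0<6+b (inj₂ refl) = ℤ.+<+ (s≤s z≤n)

-6+b<0 : ∀ {b} → b ≡ 1ℤ ⊎ b ≡ -1ℤ → ℤ.- + 6 ℤ.+ b ℤ.< 0ℤ
-6+b<0 (inj₁ refl) = ℤ.-<+
-6+b<0 (inj₂ refl) = ℤ.-<+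

module Pentagonal {b : ℤ} (b≡±1 : b ≡ 1ℤ ⊎ b ≡ -1ℤ) where

  private
    -- The number (1 + b)/2.
    h : ℕ
    h = proj₁ (half b≡±1)

    -- The pentagonal numbers k(3k + b)/2 without division, from the increments
    -- (k + 1)(3(k + 1) + b)/2 - k(3k + b)/2 = 3k + 1 + (1 + b)/2.
    P : ℕ → ℕ
    P zero    = 0
    P (suc k) = suc (3 *ℕ k +ℕ h) +ℕ P k

    2P : ∀ k → + k ℤ.* (+ 3 ℤ.* + k ℤ.+ b) ≡ + (P k *ℕ 2)
    2P zero = refl
    2P (suc k) = begin
      + suc k ℤ.* (+ 3 ℤ.* + suc k ℤ.+ b)
        ≡⟨ lem₁ (+ k) b ⟩
      + 6 ℤ.* + k ℤ.+ (+ 2 ℤ.+ (1ℤ ℤ.+ b)) ℤ.+ + k ℤ.* (+ 3 ℤ.* + k ℤ.+ b)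
        ≡⟨ cong₂ (λ x y → + 6 ℤ.* + k ℤ.+ (+ 2 ℤ.+ x) ℤ.+ y) (proj₂ (half b≡±1)) (trans (2P k) (ℤ.pos-* (P k) 2)) ⟩
      + 6 ℤ.* + k ℤ.+ (+ 2 ℤ.+ + 2 ℤ.* + h) ℤ.+ + P k ℤ.* + 2
        ≡⟨ lem₂ (+ k) (+ h) (+ P k) ⟩
      (1ℤ ℤ.+ (+ 3 ℤ.* + k ℤ.+ + h) ℤ.+ + P k) ℤ.* + 2
        ≡⟨ cong (λ x → (1ℤ ℤ.+ (x ℤ.+ + h) ℤ.+ + P k) ℤ.* + 2) (sym (ℤ.pos-* 3 k)) ⟩
      + P (suc k) ℤ.* + 2
        ≡⟨ sym (ℤ.pos-* (P (suc k)) 2) ⟩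
      + (P (suc k) *ℕ 2) ∎
      where
      open ≡-Reasoning
      lem₁ : ∀ k b → (1ℤ ℤ.+ k) ℤ.* (+ 3 ℤ.* (1ℤ ℤ.+ k) ℤ.+ b)
             ≡ + 6 ℤ.* k ℤ.+ (+ 2 ℤ.+ (1ℤ ℤ.+ b)) ℤ.+ k ℤ.* (+ 3 ℤ.* k ℤ.+ b)
      lem₁ = solve-∀
      lem₂ : ∀ k o p → + 6 ℤ.* k ℤ.+ (+ 2 ℤ.+ + 2 ℤ.* o) ℤ.+ p ℤ.* + 2
             ≡ (1ℤ ℤ.+ (+ 3 ℤ.* k ℤ.+ o) ℤ.+ p) ℤ.* + 2
      lem₂ = solve-∀

    pentagonal≡P : ∀ k → pentagonal b k ≡ P k
    pentagonal≡P k = trans (cong (λ z → ∣ z /ℕ 2 ∣) (2P k)) (m*n/n≡m (P k) 2)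

    -- Completing the square is what links the root of 24 m + 1 to the
    -- pentagonal numbers.
    [6k+b]² : ∀ k → (+ 6 ℤ.* + k ℤ.+ b) ℤ.* (+ 6 ℤ.* + k ℤ.+ b) ≡ + (24 *ℕ pentagonal b k +ℕ 1)
    [6k+b]² k = begin
      (+ 6 ℤ.* + k ℤ.+ b) ℤ.* (+ 6 ℤ.* + k ℤ.+ b)
        ≡⟨ lem₁ (+ k) b ⟩
      + 12 ℤ.* (+ k ℤ.* (+ 3 ℤ.* + k ℤ.+ b)) ℤ.+ b ℤ.* b
        ≡⟨ cong₂ (λ x y → + 12 ℤ.* x ℤ.+ y) (trans (2P k) (ℤ.pos-* (P k) 2)) (±1-square b≡±1) ⟩
      + 12 ℤ.* (+ P k ℤ.* + 2) ℤ.+ 1ℤ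
        ≡⟨ lem₂ (+ P k) ⟩
      + 24 ℤ.* + P k ℤ.+ 1ℤ
        ≡⟨ cong (ℤ._+ 1ℤ) (sym (ℤ.pos-* 24 (P k))) ⟩
      + (24 *ℕ P k +ℕ 1)
        ≡⟨ cong (λ p → + (24 *ℕ p +ℕ 1)) (sym (pentagonal≡P k)) ⟩
      + (24 *ℕ pentagonal b k +ℕ 1) ∎
      where
      open ≡-Reasoning
      lem₁ : ∀ k b → (+ 6 ℤ.* k ℤ.+ b) ℤ.* (+ 6 ℤ.* k ℤ.+ b)
             ≡ + 12 ℤ.* (k ℤ.* (+ 3 ℤ.* k ℤ.+ b)) ℤ.+ b ℤ.* b
      lem₁ = solve-∀
      lem₂ : ∀ p → + 12 ℤ.* (p ℤ.* + 2) ℤ.+ 1ℤ ≡ + 24 ℤ.* p ℤ.+ 1ℤ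
      lem₂ = solve-∀

    0<6k+b : ∀ k → 0ℤ ℤ.< + 6 ℤ.* + suc k ℤ.+ b
    0<6k+b k = ℤ.<-≤-trans (0<6+b b≡±1)
      (ℤ.+-monoˡ-≤ b (ℤ.*-monoˡ-≤-nonNeg (+ 6) {1ℤ} {+ suc k} (ℤ.+≤+ (s≤s z≤n))))

    6z+b<0 : ∀ k → + 6 ℤ.* -[1+ k ] ℤ.+ b ℤ.< 0ℤ
    6z+b<0 k = ℤ.≤-<-trans
      (ℤ.+-monoˡ-≤ b (ℤ.*-monoˡ-≤-nonNeg (+ 6) { -[1+ k ]} { -1ℤ} (ℤ.-≤- z≤n)))
      (-6+b<0 b≡±1)

    pentagonal≤ : ∀ k n → (+ 6 ℤ.* + k ℤ.+ b) ≤√ (24 *ℕ n +ℕ 1) ⇔ pentagonal b k ≤ n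
    pentagonal≤ k n = mk⇔ (⇒ k) ⇐
      where
      ⇒ : ∀ k → (+ 6 ℤ.* + k ℤ.+ b) ≤√ (24 *ℕ n +ℕ 1) → pentagonal b k ≤ n
      -- A non-positive 6k + b is at most every square root, whatever n is, but
      -- occurs only for k = 0 and b = -1.
      ⇒ zero    (inj₁ _) = subst (_≤ n) (sym (pentagonal≡P 0)) z≤n
      ⇒ (suc k) (inj₁ z≤0) = contradiction (ℤ.<-≤-trans (0<6k+b k) z≤0) (ℤ.<-irrefl refl)
      ⇒ k (inj₂ z²≤N) = ℕ.*-cancelˡ-≤ 24 (ℕ.+-cancelʳ-≤ 1 _ _
        (ℤ.drop‿+≤+ (subst (ℤ._≤ _) ([6k+b]² k) z²≤N)))
      ⇐ : pentagonal b k ≤ n → (+ 6 ℤ.* + k ℤ.+ b) ≤√ (24 *ℕ n +ℕ 1)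
      ⇐ p≤n = inj₂ (subst (ℤ._≤ _) (sym ([6k+b]² k))
        (ℤ.+≤+ (ℕ.+-monoˡ-≤ 1 (ℕ.*-monoʳ-≤ 24 p≤n))))

    +index : ∀ n → + index b n ≡ ⌊[√ 24 *ℕ n +ℕ 1 − b ]/6⌋
    +index n = ℤ.0≤i⇒+∣i∣≡i (from (⌊√−/6⌋-spec (24 *ℕ n +ℕ 1) b 0ℤ)
      (from (pentagonal≤ 0 n) (subst (_≤ n) (sym (pentagonal≡P 0)) z≤n)))

  pentagonals : Counts (index b) (pentagonal b)
  pentagonals = record
    { increasing = λ k → subst₂ _<_ (sym (pentagonal≡P k)) (sym (pentagonal≡P (suc k)))
        (ℕ.m<n+m (P k) (s≤s z≤n))
    ; adjoint = λ k n → mk⇔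
        (λ k≤c → to (pentagonal≤ k n) (to (⌊√−/6⌋-spec _ b (+ k))
          (subst (+ k ℤ.≤_) (+index n) (ℤ.+≤+ k≤c))))
        (λ p≤n → ℤ.drop‿+≤+ (subst (+ k ℤ.≤_) (sym (+index n))
          (from (⌊√−/6⌋-spec _ b (+ k)) (from (pentagonal≤ k n) p≤n))))
    }

  -- The restriction to positive numbers matters: 0 is pentagonal b 0 for both
  -- values of b, but for b = -1 the root of 1 is not 6k + b with k = 0.
  isPentagonal : ∀ m → [√ 24 *ℕ suc m +ℕ 1 − b ]/6∈ℤ ⇔ (∃ λ k → pentagonal b k ≡ suc m)
  isPentagonal m = mk⇔ ⇒ ⇐
    where
    ⇒ : [√ 24 *ℕ suc m +ℕ 1 − b ]/6∈ℤ → ∃ λ k → pentagonal b k ≡ suc m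
    ⇒ (+ k , _ , z²≡N) = k , ℕ.*-cancelˡ-≡ _ _ 24 (ℕ.+-cancelʳ-≡ 1 _ _
      (ℤ.+-injective (trans (sym ([6k+b]² k)) z²≡N)))
    ⇒ (-[1+ k ] , 0≤z , _) = contradiction (ℤ.<-≤-trans (6z+b<0 k) 0≤z) (ℤ.<-irrefl refl)
    ⇐ : (∃ λ k → pentagonal b k ≡ suc m) → [√ 24 *ℕ suc m +ℕ 1 − b ]/6∈ℤ
    ⇐ (zero , p≡) = contradiction (trans (sym (pentagonal≡P 0)) p≡) λ ()
    ⇐ (suc k , p≡) = + suc k , ℤ.<⇒≤ (0<6k+b k) ,
      trans ([6k+b]² (suc k)) (cong (λ p → + (24 *ℕ p +ℕ 1)) p≡)

-- Sums over a commutative ring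

module Sums {c ℓ} (R : CommutativeRing c ℓ) where

  open CommutativeRing R renaming (refl to ≈-refl; sym to ≈-sym; trans to ≈-trans; _*_ to _⊗_; _+_ to _⊕_)
  open Sequences R
  open import Algebra.Properties.CommutativeMonoid.Sum +-commutativeMonoid
    using (sum-cong-≋; sum-permute; ∑-comm; ∑-distrib-+)
  open import Algebra.Properties.Semiring.Sum semiring using (*-distribˡ-sum; *-distribʳ-sum)
  open import Algebra.Properties.Ring ring using (-1*x≈-x)
  open import Relation.Binary.Reasoning.Setoid setoid

  [_]δ≈1 : ∀ {p} {P : Set p} (P? : Dec P) → P → [ P? ]δ ≈ 1#
  [ P? ]δ≈1 p rewrite dec-true P? p = ≈-refl

  [_]δ≈0 : ∀ {p} {P : Set p} (P? : Dec P) → ¬ P → [ P? ]δ ≈ 0#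
  [ P? ]δ≈0 ¬p rewrite dec-false P? ¬p = ≈-refl

  ∑₁-cong : ∀ n {F G : ArithmeticFunction} →
    (∀ k .{{_ : NonZero k}} → k ≤ n → F k ≈ G k) → ∑₁ n F ≈ ∑₁ n G
  ∑₁-cong n F≈G = sum-cong-≋ λ j → F≈G (suc (toℕ j)) (toℕ<n j)

  ∑₁-distrib-⊕ : ∀ n (F G : ArithmeticFunction) → ∑₁ n (λ k → F k ⊕ G k) ≈ ∑₁ n F ⊕ ∑₁ n G
  ∑₁-distrib-⊕ n F G = ∑-distrib-+ {n} (λ j → F (suc (toℕ j))) (λ j → G (suc (toℕ j)))

  ∑₁-suc : ∀ n (F : ArithmeticFunction) → ∑₁ (suc n) F ≈ ∑₁ n F ⊕ F (suc n)
  ∑₁-suc zero    F = +-comm _ _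
  ∑₁-suc (suc n) F = ≈-trans (+-congˡ (∑₁-suc n (λ k → F (suc k)))) (≈-sym (+-assoc _ _ _))

  ∑₁-truncate : ∀ {m n} (F : ArithmeticFunction) → m ≤ n →
    (∀ k .{{_ : NonZero k}} → m < k → F k ≈ 0#) → ∑₁ n F ≈ ∑₁ m F
  ∑₁-truncate {m} {zero} F z≤n F≈0 = ≈-refl
  ∑₁-truncate {m} {suc n} F m≤n F≈0 with ℕ.m≤n⇒m<n∨m≡n m≤n
  ... | inj₂ refl = ≈-refl
  ... | inj₁ m<1+n = begin
    ∑₁ (suc n) F        ≈⟨ ∑₁-suc n F ⟩
    ∑₁ n F ⊕ F (suc n)  ≈⟨ +-cong (∑₁-truncate F (ℕ.≤-pred m<1+n) F≈0) (F≈0 (suc n) m<1+n) ⟩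
    ∑₁ m F ⊕ 0#         ≈⟨ +-identityʳ _ ⟩
    ∑₁ m F              ∎

  ∑₁-reverse : ∀ n (G : ℕ → Carrier) →
    ∑₁ (suc n) (λ m → G (suc n ∸ m)) ≈ G 0 ⊕ ∑₁ n (λ j → G j)
  ∑₁-reverse n G = begin
    ∑[ j < suc n ] G (n ∸ toℕ j)
      ≈⟨ sum-cong-≋ {suc n} (λ j → reflexive (cong G (sym (opposite-prop j)))) ⟩
    ∑[ j < suc n ] G (toℕ (opposite j))
      ≈⟨ sum-permute {suc n} (λ j → G (toℕ j)) reverse ⟨
    ∑[ j < suc n ] G (toℕ j) ∎

  -- A sum over all m ≤ n, restricted to the values of the sequence p, is a sum
  -- over the indices of p.
  ∑-image : ∀ {c p} → Counts c p →
    ∀ {q} {P : ℕ → Set q} (P? : ∀ m → Dec (P m)) →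
    (∀ m → P (suc m) ⇔ (∃ λ k → p k ≡ suc m)) →
    (G : ℕ → Carrier) (n : ℕ) →
    ∑₁ n (λ m → G m ⊗ [ P? m ]δ) ≈ ∑₁ (c n) (λ k → G (p k))
  ∑-image {c} {p} counts P? P⇔ G = go
    where
    open Counts counts
    go : ∀ n → ∑₁ n (λ m → G m ⊗ [ P? m ]δ) ≈ ∑₁ (c n) (λ k → G (p k))
    go zero rewrite c-zero = ≈-refl
    go (suc n) with P? (suc n)
    ... | yes q with to (P⇔ n) q
    ...   | k , pk≡ = begin
      ∑₁ (suc n) (λ m → G m ⊗ [ P? m ]δ)
        ≈⟨ ∑₁-suc n (λ m → G m ⊗ [ P? m ]δ) ⟩
      ∑₁ n (λ m → G m ⊗ [ P? m ]δ) ⊕ G (suc n) ⊗ [ P? (suc n) ]δ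
        ≈⟨ +-cong (go n) (≈-trans (*-congˡ ([ P? (suc n) ]δ≈1 q)) (*-identityʳ _)) ⟩
      ∑₁ (c n) (λ k → G (p k)) ⊕ G (suc n)
        ≡⟨ cong (λ m → ∑₁ (c n) (λ k → G (p k)) ⊕ G m) (sym p[1+c]) ⟩
      ∑₁ (c n) (λ k → G (p k)) ⊕ G (p (suc (c n)))
        ≈⟨ ∑₁-suc (c n) (λ k → G (p k)) ⟨
      ∑₁ (suc (c n)) (λ k → G (p k))
        ≡⟨ cong (λ l → ∑₁ l (λ k → G (p k))) (sym (c-hit pk≡)) ⟩
      ∑₁ (c (suc n)) (λ k → G (p k)) ∎
      where
      p[1+c] : p (suc (c n)) ≡ suc n
      p[1+c] = trans (cong p (trans (sym (c-hit pk≡)) (trans (cong c (sym pk≡)) (c∘p k)))) pk≡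
    go (suc n) | no ¬q = begin
      ∑₁ (suc n) (λ m → G m ⊗ [ P? m ]δ)
        ≈⟨ ∑₁-suc n (λ m → G m ⊗ [ P? m ]δ) ⟩
      ∑₁ n (λ m → G m ⊗ [ P? m ]δ) ⊕ G (suc n) ⊗ [ P? (suc n) ]δ
        ≈⟨ +-cong (go n) (≈-trans (*-congˡ ([ P? (suc n) ]δ≈0 ¬q)) (zeroʳ _)) ⟩
      ∑₁ (c n) (λ k → G (p k)) ⊕ 0#
        ≈⟨ +-identityʳ _ ⟩
      ∑₁ (c n) (λ k → G (p k))
        ≡⟨ cong (λ l → ∑₁ l (λ k → G (p k))) (sym (c-miss (¬q ∘ from (P⇔ n)))) ⟩
      ∑₁ (c (suc n)) (λ k → G (p k)) ∎

  -- The signed indicator of pentagonal numbers: (-1)^k if m = k(3k + b)/2 with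
  -- 6k + b ≥ 0, and 0 if m is not of this form.
  e : ℤ → ℕ → Carrier
  e b m = ((- 1#) ^ index b m) ⊗ [ [√ 24 *ℕ m +ℕ 1 − b ]/6∈ℤ? ]δ

  -- Divisor sums and their pentagonal recurrence

  module _ (f : ArithmeticFunction) where

    -- Collects the terms of a double sum over the products s i ≤ N by the value
    -- m of the product.
    lambert : ∀ N (h : ℕ → Carrier) →
      ∑₁ N (λ i → f i ⊗ ∑₁ (N / i) (λ s → h (s *ℕ i))) ≈ ∑₁ N (λ m → g f m ⊗ h m)
    lambert N h = begin
      ∑₁ N (λ i → f i ⊗ ∑₁ (N / i) (λ s → h (s *ℕ i)))
        ≈⟨ ∑₁-cong N (λ i _ → ≈-trans (*-congˡ (≈-sym (∑-image (multiples i) (i ∣ℕ?_) ∣⇔ h N)))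
             (*-distribˡ-sum {N} (f i) _)) ⟩
      ∑₁ N (λ i → ∑₁ N λ m → f i ⊗ (h m ⊗ [ i ∣ℕ? m ]δ))
        ≈⟨ ∑-comm {N} {N} _ ⟩
      ∑₁ N (λ m → ∑₁ N λ i → f i ⊗ (h m ⊗ [ i ∣ℕ? m ]δ))
        ≈⟨ ∑₁-cong N inner ⟩
      ∑₁ N (λ m → g f m ⊗ h m) ∎
      where
      ∣⇔ : ∀ {i} m → (i ∣ suc m) ⇔ (∃ λ k → k *ℕ i ≡ suc m)
      ∣⇔ m = mk⇔ (λ { (divides k eq) → k , sym eq }) (λ { (k , eq) → divides k (sym eq) })
      rearrange : ∀ x y z → x ⊗ (y ⊗ z) ≈ (z ⊗ x) ⊗ y
      rearrange x y z = ≈-trans (*-congˡ (*-comm y z))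
        (≈-trans (≈-sym (*-assoc x z y)) (*-congʳ (*-comm x z)))
      inner : ∀ m .{{_ : NonZero m}} → m ≤ N →
        ∑₁ N (λ i → f i ⊗ (h m ⊗ [ i ∣ℕ? m ]δ)) ≈ g f m ⊗ h m
      inner m m≤N = begin
        ∑₁ N (λ i → f i ⊗ (h m ⊗ [ i ∣ℕ? m ]δ))
          ≈⟨ ∑₁-cong N (λ i _ → rearrange (f i) (h m) [ i ∣ℕ? m ]δ) ⟩
        ∑₁ N (λ i → ([ i ∣ℕ? m ]δ ⊗ f i) ⊗ h m)
          ≈⟨ *-distribʳ-sum {N} (h m) _ ⟨
        ∑₁ N (λ i → [ i ∣ℕ? m ]δ ⊗ f i) ⊗ h m
          -- No i > m divides m, so the sum up to N stops at m.
          ≈⟨ *-congʳ (∑₁-truncate (λ i → [ i ∣ℕ? m ]δ ⊗ f i) m≤N λ i m<i →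
               ≈-trans (*-congʳ ([ i ∣ℕ? m ]δ≈0 λ i∣m → ℕ.<⇒≱ m<i (∣⇒≤ i∣m))) (zeroˡ _)) ⟩
        g f m ⊗ h m ∎

    convolution : ∀ n → a[ f ] (suc n) ≈ ∑± λ b → ∑₁ (suc n) λ m → g f m ⊗ e b (suc n ∸ m)
    convolution n = begin
      ∑₁ N (λ i → f i ⊗ a N i) ⊕ 0#
        ≈⟨ +-identityʳ _ ⟩
      ∑₁ N (λ i → f i ⊗ a N i)
        ≈⟨ ∑₁-cong N (λ i _ → distribˡ (f i) (T 1ℤ i) (T -1ℤ i)) ⟩
      ∑₁ N (λ i → f i ⊗ T 1ℤ i ⊕ f i ⊗ T -1ℤ i)
        ≈⟨ ∑₁-distrib-⊕ N (λ i → f i ⊗ T 1ℤ i) (λ i → f i ⊗ T -1ℤ i) ⟩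
      (∑± λ b → ∑₁ N (λ i → f i ⊗ T b i))
        ≈⟨ +-cong (lambert N (λ m → e 1ℤ (N ∸ m))) (lambert N (λ m → e -1ℤ (N ∸ m))) ⟩
      (∑± λ b → ∑₁ N λ m → g f m ⊗ e b (N ∸ m)) ∎
      where
      N = suc n
      T : ℤ → ArithmeticFunction
      T b i = ∑₁ (N / i) (λ s → e b (N ∸ s *ℕ i))

    pentagonal-sum : ∀ {b} → b ≡ 1ℤ ⊎ b ≡ -1ℤ → ∀ n →
      ∑₁ (suc n) (λ m → g f m ⊗ e b (suc n ∸ m))
        ≈ g f (suc n) ⊗ e b 0 ⊕ ∑₁ (index b n) (λ k → (- 1#) ^ k ⊗ g f (suc n ∸ pentagonal b k))
    pentagonal-sum {b} b≡±1 n = begin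
      ∑₁ N (λ m → g f m ⊗ e b (N ∸ m))
        ≈⟨ ∑₁-cong N (λ m m≤N → reflexive (cong (λ l → g f l ⊗ e b (N ∸ m)) (sym (ℕ.m∸[m∸n]≡n m≤N)))) ⟩
      ∑₁ N (λ m → g f (N ∸ (N ∸ m)) ⊗ e b (N ∸ m))
        ≈⟨ ∑₁-reverse n (λ j → g f (N ∸ j) ⊗ e b j) ⟩
      g f N ⊗ e b 0 ⊕ ∑₁ n (λ j → g f (N ∸ j) ⊗ e b j)
        ≈⟨ +-congˡ (∑₁-cong n λ j _ → rearrange (g f (N ∸ j)) ((- 1#) ^ index b j) [ [√ 24 *ℕ j +ℕ 1 − b ]/6∈ℤ? ]δ) ⟩
      g f N ⊗ e b 0 ⊕ ∑₁ n (λ j → G j ⊗ [ [√ 24 *ℕ j +ℕ 1 − b ]/6∈ℤ? ]δ)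
        -- G is stated through index b j, which is k at j = pentagonal b k.
        ≈⟨ +-congˡ (∑-image pentagonals (λ m → [√ 24 *ℕ m +ℕ 1 − b ]/6∈ℤ?) isPentagonal G n) ⟩
      g f N ⊗ e b 0 ⊕ ∑₁ (index b n) (λ k → G (pentagonal b k))
        ≈⟨ +-congˡ (∑₁-cong (index b n) λ k _ →
             *-congʳ {g f (N ∸ pentagonal b k)} (reflexive (cong ((- 1#) ^_) (Counts.c∘p pentagonals k)))) ⟩
      g f N ⊗ e b 0 ⊕ ∑₁ (index b n) (λ k → (- 1#) ^ k ⊗ g f (N ∸ pentagonal b k)) ∎
      where
      open Pentagonal b≡±1
      N = suc n
      G : ℕ → Carrier
      G j = (- 1#) ^ index b j ⊗ g f (N ∸ j)
      rearrange : ∀ x y z → x ⊗ (y ⊗ z) ≈ (y ⊗ x) ⊗ z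
      rearrange x y z = ≈-trans (≈-sym (*-assoc x y z)) (*-congʳ (*-comm x y))

    recurrence : ∀ n → g f (suc n) ≈
      (∑± λ b → ∑₁ (index b n) λ k → ((- 1#) ^ (k +ℕ 1)) ⊗ g f (suc n ∸ pentagonal b k)) ⊕ a[ f ] (suc n)
    recurrence n = ≈-sym (begin
      (A 1ℤ ⊕ A -1ℤ) ⊕ a[ f ] (suc n)
        ≈⟨ +-congˡ (convolution n) ⟩
      (A 1ℤ ⊕ A -1ℤ) ⊕ (∑± λ b → ∑₁ (suc n) λ m → g f m ⊗ e b (suc n ∸ m))
        ≈⟨ +-congˡ (+-cong (pentagonal-sum (inj₁ refl) n) (pentagonal-sum (inj₂ refl) n)) ⟩
      (A 1ℤ ⊕ A -1ℤ) ⊕ ((g f (suc n) ⊗ e 1ℤ 0 ⊕ B 1ℤ) ⊕ (g f (suc n) ⊗ e -1ℤ 0 ⊕ B -1ℤ))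
        -- e 1ℤ 0 computes to 1# ⊗ 1# and e -1ℤ 0 to 1# ⊗ 0#.
        ≈⟨ +-congˡ (+-cong (+-congʳ (≈-trans (*-congˡ (*-identityˡ 1#)) (*-identityʳ _)))
                           (≈-trans (+-congʳ (≈-trans (*-congˡ (zeroʳ _)) (zeroʳ _))) (+-identityˡ _))) ⟩
      (A 1ℤ ⊕ A -1ℤ) ⊕ ((g f (suc n) ⊕ B 1ℤ) ⊕ B -1ℤ)
        ≈⟨ +-cong (+-comm _ _) (+-assoc _ _ _) ⟩
      (A -1ℤ ⊕ A 1ℤ) ⊕ (g f (suc n) ⊕ (B 1ℤ ⊕ B -1ℤ))
        ≈⟨ +-comm _ _ ⟩
      (g f (suc n) ⊕ (B 1ℤ ⊕ B -1ℤ)) ⊕ (A -1ℤ ⊕ A 1ℤ)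
        ≈⟨ +-assoc _ _ _ ⟩
      g f (suc n) ⊕ ((B 1ℤ ⊕ B -1ℤ) ⊕ (A -1ℤ ⊕ A 1ℤ))
        ≈⟨ +-congˡ cancel ⟩
      g f (suc n) ⊕ 0#
        ≈⟨ +-identityʳ _ ⟩
      g f (suc n) ∎)
      where
      A B : ℤ → Carrier
      A b = ∑₁ (index b n) λ k → ((- 1#) ^ (k +ℕ 1)) ⊗ g f (suc n ∸ pentagonal b k)
      B b = ∑₁ (index b n) λ k → (- 1#) ^ k ⊗ g f (suc n ∸ pentagonal b k)
      A≈-B : ∀ b → A b ≈ - B b
      A≈-B b = begin
        A b
          ≈⟨ ∑₁-cong (index b n) (λ k _ → ≈-trans
               (*-congʳ {g f (suc n ∸ pentagonal b k)} (reflexive (cong ((- 1#) ^_) (ℕ.+-comm k 1))))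
               (*-assoc (- 1#) ((- 1#) ^ k) _)) ⟩
        ∑₁ (index b n) (λ k → - 1# ⊗ ((- 1#) ^ k ⊗ g f (suc n ∸ pentagonal b k)))
          ≈⟨ *-distribˡ-sum {index b n} (- 1#) _ ⟨
        - 1# ⊗ B b
          ≈⟨ -1*x≈-x (B b) ⟩
        - B b ∎
      cancel : (B 1ℤ ⊕ B -1ℤ) ⊕ (A -1ℤ ⊕ A 1ℤ) ≈ 0#
      cancel = begin
        (B 1ℤ ⊕ B -1ℤ) ⊕ (A -1ℤ ⊕ A 1ℤ)
          ≈⟨ +-assoc _ _ _ ⟩
        B 1ℤ ⊕ (B -1ℤ ⊕ (A -1ℤ ⊕ A 1ℤ))
          ≈⟨ +-congˡ (≈-sym (+-assoc _ _ _)) ⟩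
        B 1ℤ ⊕ ((B -1ℤ ⊕ A -1ℤ) ⊕ A 1ℤ)
          ≈⟨ +-congˡ (≈-trans (+-congʳ (≈-trans (+-congˡ (A≈-B -1ℤ)) (-‿inverseʳ _))) (+-identityˡ _)) ⟩
        B 1ℤ ⊕ A 1ℤ
          ≈⟨ ≈-trans (+-congˡ (A≈-B 1ℤ)) (-‿inverseʳ _) ⟩
        0# ∎

theorem1p4 : ∀ {c ℓ} (R : CommutativeRing c ℓ) →
    let open CommutativeRing R
        open Sequences R in
    (f : ArithmeticFunction) (n : ℕ) → 1 ≤ n →
    g f (n +ℕ 1) ≈
      (∑± λ b → ∑₁ (index b n) λ k →
        ((- 1#) ^ (k +ℕ 1)) * g f ((n +ℕ 1) ∸ pentagonal b k))
      + a[ f ] (n +ℕ 1)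
theorem1p4 R f n _ rewrite ℕ.+-comm n 1 = Sums.recurrence R f n
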